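{- The cut rule is eliminable in the calculus $\mathrm{L}^{\circlearrowleft}$ (the Lambek calculus with cyclic shift): every sequent derivable in $\mathrm{L}^{\circlearrowleft}$ has a derivation in $\mathrm{L}^{\circlearrowleft}$ that does not use the rule $(\mathrm{cut})$.
   Context: Types of $\mathrm{L}^{\circlearrowleft}$ are built from primitive types (elements of a fixed set $Pr$) using the binary connectives $\backslash$, $/$, $\cdot$ and a unary connective $A\mapsto A^{\circlearrowleft}$. A sequent is an expression $A_1,\dots,A_n\to B$ where $n\ge 1$ and $A_i,B$ are types. Capital Latin letters denote types, $\Gamma,\Delta$ denote finite (possibly empty) sequences of types, and $\Pi,\Psi$ denote nonempty finite sequences of types. The axioms and rules of $\mathrm{L}^{\circlearrowleft}$ are: - $(\mathrm{Ax})$: $A\to A$. - $(\backslash\to)$: from $\Gamma,B,\Delta\to C$ and $\Pi\to A$ infer $\Gamma,\Pi,A\backslash B,\Delta\to C$. - $(\to\backslash)$: from $A,\Pi\to B$ infer $\Pi\to A\backslash B$. - $(/\to)$: from $\Gamma,B,\Delta\to C$ and $\Pi\to A$ infer $\Gamma,B/A,\Pi,\Delta\to C$. - $(\to/)$: from $\Pi,A\to B$ infer $\Pi\to B/A$. - $(\cdot\to)$: from $\Gamma,A,B,\Delta\to C$ infer $\Gamma,A\cdot B,\Delta\to C$. - $(\to\cdot)$: from $\Pi\to A$ and $\Psi\to B$ infer $\Pi,\Psi\to A\cdot B$. - $(\mathrm{cut})$: from $\Pi\to A$ and $\Gamma,A,\Delta\to B$ infer $\Gamma,\Pi,\Delta\to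 B$. - $(\to^{\circlearrowleft})$: from $\Pi\to A$ infer $\Pi\to A^{\circlearrowleft}$. - $(^{\circlearrowleft}\to)$: from $B\to A^{\circlearrowleft}$ infer $B^{\circlearrowleft}\to A^{\circlearrowleft}$. - $(\circlearrowleft)$: from $\Pi,\Psi\to A^{\circlearrowleft}$ infer $\Psi,\Pi\to A^{\circlearrowleft}$. -}

module Defs where

open import Data.Empty using (⊥)
open import Data.List.Base using (List; []; _∷_)
open import Data.List.NonEmpty.Base
  using (List⁺; _∷_; [_]; _∷⁺_; _++⁺_; _⁺++_; _⁺++⁺_; _⁺∷ʳ_)
open import Data.Product.Base using (_×_)
open import Data.Unit.Base using (⊤)
open import Level using (Level)

infixr 7 _\\_
infixl 7 _//_
infixl 8 _·_
infix  9 _↻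
infix  4 _⊢_

data Type {a : Level} (Pr : Set a) : Set a where
  prim : Pr → Type Pr
  _\\_ : Type Pr → Type Pr → Type Pr
  _//_ : Type Pr → Type Pr → Type Pr
  _·_  : Type Pr → Type Pr → Type Pr
  _↻   : Type Pr → Type Pr

-- Derivations, as proof-relevant trees.  Antecedents are nonempty, so the
-- possibly empty contexts Γ, Δ are lists while Π, Ψ are nonempty lists.
data _⊢_ {a : Level} {Pr : Set a} : List⁺ (Type Pr) → Type Pr → Set a where
  ax  : ∀ {A} → [ A ] ⊢ A
  \\L : ∀ {Γ Δ Π A B C} →
        Γ ++⁺ (B ∷ Δ) ⊢ C → Π ⊢ A →
        Γ ++⁺ (Π ⁺++ (A \\ B ∷ Δ)) ⊢ C
  \\R : ∀ {Π A B} → A ∷⁺ Π ⊢ B → Π ⊢ A \\ B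
  //L : ∀ {Γ Δ Π A B C} →
        Γ ++⁺ (B ∷ Δ) ⊢ C → Π ⊢ A →
        Γ ++⁺ (B // A ∷⁺ (Π ⁺++ Δ)) ⊢ C
  //R : ∀ {Π A B} → Π ⁺∷ʳ A ⊢ B → Π ⊢ B // A
  ·L  : ∀ {Γ Δ A B C} →
        Γ ++⁺ (A ∷ B ∷ Δ) ⊢ C →
        Γ ++⁺ (A · B ∷ Δ) ⊢ C
  ·R  : ∀ {Π Ψ A B} → Π ⊢ A → Ψ ⊢ B → Π ⁺++⁺ Ψ ⊢ A · B
  cut : ∀ {Γ Δ Π A B} →
        Π ⊢ A → Γ ++⁺ (A ∷ Δ) ⊢ B →
        Γ ++⁺ (Π ⁺++ Δ) ⊢ B
  ↻R  : ∀ {Π A} → Π ⊢ A → Π ⊢ A ↻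
  ↻L  : ∀ {A B} → [ B ] ⊢ A ↻ → [ B ↻ ] ⊢ A ↻
  ↻   : ∀ {Π Ψ A} → Π ⁺++⁺ Ψ ⊢ A ↻ → Ψ ⁺++⁺ Π ⊢ A ↻

CutFree : ∀ {a} {Pr : Set a} {Π : List⁺ (Type Pr)} {C : Type Pr} → Π ⊢ C → Set
CutFree ax        = ⊤
CutFree (\\L d e) = CutFree d × CutFree e
CutFree (\\R d)   = CutFree d
CutFree (//L d e) = CutFree d × CutFree e
CutFree (//R d)   = CutFree d
CutFree (·L d)    = CutFree d
CutFree (·R d e)  = CutFree d × CutFree e
CutFree (cut _ _) = ⊥
CutFree (↻R d)    = CutFree d
CutFree (↻L d)    = CutFree d
CutFree (↻ d)     = CutFree d

{-# OPTIONS --safe #-}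

-- Cut elimination by completeness: types are interpreted as sets of antecedents
-- closed under the cut-free consequences, so that the cut rule holds in the model,
-- A ∈ ⟦ A ⟧, and every member of ⟦ A ⟧ derives A without cut.  The crucial clause
-- takes ⟦ A ↻ ⟧ to be the intersection of all sets { L ∣ L ⊩ D ↻ } containing ⟦ A ⟧.
-- Each of these is invariant under rotation, and the intersection is monotone and
-- idempotent in ⟦ A ⟧, which validates the rule ↻L.
module Submission where

-- The rule ↻ is renamed: otherwise A ↻ also parses as an application to it.
open import Defs renaming (↻ to rotate)
open import Data.Empty.Polymorphic using (⊥)
open import Data.List.Base using (List; []; _∷_; _++_)
open import Data.List.NonEmpty.Base using (List⁺; _∷_; toList; _++⁺_)
open import Data.List.Properties using (++-assoc; ++-identityʳ)
open import Data.Product.Base using (Σ-syntax; ∃₂; _×_; _,_; proj₁; proj₂)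
open import Data.Unit.Base using (tt)
open import Level using (Level)
open import Relation.Binary.PropositionalEquality
  using (_≡_; _≢_; refl; sym; trans; cong; subst)
open import Relation.Nullary.Negation.Core using (contradiction)

private
  variable
    a : Level
    Pr : Set a
    A B C : Type Pr
    L M N : List (Type Pr)

infix 4 _⊩_

-- Cut-free derivability, with antecedents as plain lists: since toList Π unfolds
-- to a cons cell, toList Π ⊩ C is definitionally Σ[ d ∈ Π ⊢ C ] CutFree d.
_⊩_ : {Pr : Set a} → List (Type Pr) → Type Pr → Set a
[]    ⊩ C = ⊥
A ∷ Γ ⊩ C = Σ[ d ∈ (A ∷ Γ) ⊢ C ] CutFree d

toList-++⁺ : ∀ Γ (Π : List⁺ (Type Pr)) → toList (Γ ++⁺ Π) ≡ Γ ++ toList Π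
toList-++⁺ []      Π = refl
toList-++⁺ (A ∷ Γ) Π = cong (A ∷_) (toList-++⁺ Γ Π)

toList-++⁺⇒ : ∀ Γ (Π : List⁺ (Type Pr)) → toList (Γ ++⁺ Π) ⊩ C → Γ ++ toList Π ⊩ C
toList-++⁺⇒ {C = C} Γ Π = subst (_⊩ C) (toList-++⁺ Γ Π)

++⇒toList-++⁺ : ∀ Γ (Π : List⁺ (Type Pr)) → Γ ++ toList Π ⊩ C → toList (Γ ++⁺ Π) ⊩ C
++⇒toList-++⁺ {C = C} Γ Π = subst (_⊩ C) (sym (toList-++⁺ Γ Π))

⊩-\\L : ∀ Γ Δ M → Γ ++ B ∷ Δ ⊩ C → M ⊩ A → Γ ++ M ++ A \\ B ∷ Δ ⊩ C
⊩-\\L Γ Δ (_ ∷ _) p (e , e-cf) with ++⇒toList-++⁺ Γ (_ ∷ Δ) p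
... | d , d-cf = toList-++⁺⇒ Γ _ (\\L {Γ = Γ} {Δ = Δ} d e , d-cf , e-cf)

⊩-//L : ∀ Γ Δ M → Γ ++ B ∷ Δ ⊩ C → M ⊩ A → Γ ++ B // A ∷ M ++ Δ ⊩ C
⊩-//L Γ Δ (_ ∷ _) p (e , e-cf) with ++⇒toList-++⁺ Γ (_ ∷ Δ) p
... | d , d-cf = toList-++⁺⇒ Γ _ (//L {Γ = Γ} {Δ = Δ} d e , d-cf , e-cf)

⊩-·L : ∀ Γ Δ → Γ ++ A ∷ B ∷ Δ ⊩ C → Γ ++ A · B ∷ Δ ⊩ C
⊩-·L Γ Δ p with ++⇒toList-++⁺ Γ _ p
... | d , d-cf = toList-++⁺⇒ Γ _ (·L {Γ = Γ} {Δ = Δ} d , d-cf)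

⊩-\\R : L ≢ [] → A ∷ L ⊩ B → L ⊩ A \\ B
⊩-\\R {L = []}    L≢[] _          = contradiction refl L≢[]
⊩-\\R {L = _ ∷ _} _    (d , d-cf) = \\R d , d-cf

⊩-//R : L ≢ [] → L ++ A ∷ [] ⊩ B → L ⊩ B // A
⊩-//R {L = []}    L≢[] _          = contradiction refl L≢[]
⊩-//R {L = _ ∷ _} _    (d , d-cf) = //R d , d-cf

⊩-·R : L ⊩ A → M ⊩ B → L ++ M ⊩ A · B
⊩-·R {L = _ ∷ _} {M = _ ∷ _} (d , d-cf) (e , e-cf) = ·R d e , d-cf , e-cf

⊩-↻R : L ⊩ A → L ⊩ A ↻
⊩-↻R {L = _ ∷ _} (d , d-cf) = ↻R d , d-cf

-- Rotation changes nothing when `M` or `N` is empty; covering these cases lets `sound` rotate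
-- without proving both parts nonempty.
⊩-↻ : ∀ M N → M ++ N ⊩ A ↻ → N ++ M ⊩ A ↻
⊩-↻ {A = A} []      N       p = subst (_⊩ A ↻) (sym (++-identityʳ N)) p
⊩-↻ {A = A} (_ ∷ _) []      p = subst (_⊩ A ↻) (++-identityʳ _) p
⊩-↻         (x ∷ M) (y ∷ N) (d , d-cf) = rotate {Π = x ∷ M} {Ψ = y ∷ N} d , d-cf

-- The first components for \\ and // exclude the empty antecedent.
⟦_⟧ : {Pr : Set a} → Type Pr → List (Type Pr) → Set a
⟦ prim p ⟧ L = L ⊩ prim p
⟦ A \\ B ⟧ L = L ⊩ A \\ B × (∀ {M} → ⟦ A ⟧ M → ⟦ B ⟧ (M ++ L))
⟦ B // A ⟧ L = L ⊩ B // A × (∀ {M} → ⟦ A ⟧ M → ⟦ B ⟧ (L ++ M))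
⟦ A · B  ⟧ L = ∀ Γ Δ D → (∀ {M N} → ⟦ A ⟧ M → ⟦ B ⟧ N → Γ ++ (M ++ N) ++ Δ ⊩ D) →
               Γ ++ L ++ Δ ⊩ D
⟦ A ↻    ⟧ L = ∀ D → (∀ {M} → ⟦ A ⟧ M → M ⊩ D ↻) → L ⊩ D ↻

reify : ∀ A → ⟦ A ⟧ L → L ⊩ A
reify (prim p) x = x
reify (A \\ B) x = proj₁ x
reify (B // A) x = proj₁ x
reify (A · B)  x =
  subst (_⊩ A · B) (++-identityʳ _)
    (x [] [] (A · B) λ {M} {N} m n →
      subst (_⊩ A · B) (sym (++-identityʳ (M ++ N))) (⊩-·R (reify A m) (reify B n)))
reify (A ↻)    x = x A λ m → ⊩-↻R (reify A m)

-- The biorthogonal closure of `X`, tested by cut-free sequents with a hole in the antecedent. Up to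
-- currying, `⟦ A · B ⟧` is the closure of the products of members of `⟦ A ⟧` and `⟦ B ⟧`.
Closure : {Pr : Set a} → (List (Type Pr) → Set a) → List (Type Pr) → Set a
Closure X L = ∀ Γ Δ D → (∀ {M} → X M → Γ ++ M ++ Δ ⊩ D) → Γ ++ L ++ Δ ⊩ D

++-nest : (Γ′ Γ L Δ Δ′ : List (Type Pr)) →
          (Γ′ ++ Γ) ++ L ++ Δ ++ Δ′ ≡ Γ′ ++ (Γ ++ L ++ Δ) ++ Δ′
++-nest Γ′ Γ L Δ Δ′ = trans (++-assoc Γ′ Γ _) (cong (Γ′ ++_) (sym (++-assoc₃ Γ L Δ Δ′)))
  where
  ++-assoc₃ : (K L M N : List (Type _)) → (K ++ L ++ M) ++ N ≡ K ++ L ++ M ++ N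
  ++-assoc₃ K L M N = trans (++-assoc K _ N) (cong (K ++_) (++-assoc L M N))

-- Every clause of `⟦_⟧` comes down to cut-free derivability, so arguments and outer contexts are
-- absorbed into `Γ` and `Δ` until `cl` applies.
⟦⟧-closed : ∀ {Pr : Set a} {L : List (Type Pr)} {X : List (Type Pr) → Set a} C Γ Δ →
            Closure X L → (∀ {M} → X M → ⟦ C ⟧ (Γ ++ M ++ Δ)) → ⟦ C ⟧ (Γ ++ L ++ Δ)
⟦⟧-closed (prim p) Γ Δ cl f = cl Γ Δ (prim p) f
⟦⟧-closed (A \\ B) Γ Δ cl f =
  cl Γ Δ (A \\ B) (λ x → proj₁ (f x)) ,
  λ {K} k → subst ⟦ B ⟧ (++-assoc K Γ _)
    (⟦⟧-closed B (K ++ Γ) Δ cl λ x → subst ⟦ B ⟧ (sym (++-assoc K Γ _)) (proj₂ (f x) k))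
⟦⟧-closed {L = L} (B // A) Γ Δ cl f =
  cl Γ Δ (B // A) (λ x → proj₁ (f x)) ,
  λ {K} k → subst ⟦ B ⟧ (++-nest [] Γ L Δ K)
    (⟦⟧-closed B Γ (Δ ++ K) cl λ {M} x →
      subst ⟦ B ⟧ (sym (++-nest [] Γ M Δ K)) (proj₂ (f x) k))
⟦⟧-closed {L = L} (A · B) Γ Δ cl f Γ′ Δ′ D g =
  subst (_⊩ D) (++-nest Γ′ Γ L Δ Δ′)
    (cl (Γ′ ++ Γ) (Δ ++ Δ′) D λ {M} x →
      subst (_⊩ D) (sym (++-nest Γ′ Γ M Δ Δ′)) (f x Γ′ Δ′ D g))
⟦⟧-closed (A ↻) Γ Δ cl f D g = cl Γ Δ (D ↻) λ x → f x D g

-- A left rule that replaces `A` by `L` puts `L` in the closure of the singleton of `A`; `reflect`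
-- uses the division rules in this way.
⟦⟧-closed₁ : ∀ B → (∀ Γ Δ D → Γ ++ A ∷ Δ ⊩ D → Γ ++ L ++ Δ ⊩ D) →
             ⟦ B ⟧ (A ∷ []) → ⟦ B ⟧ L
⟦⟧-closed₁ {A = A} {L = L} B cl b =
  subst ⟦ B ⟧ (++-identityʳ L)
    (⟦⟧-closed {X = _≡ A ∷ []} B [] [] (λ Γ Δ D f → cl Γ Δ D (f refl)) λ { refl → b })

reflect : (A : Type Pr) → ⟦ A ⟧ (A ∷ [])
reflect (prim p) = ax , tt
reflect (A \\ B) = (ax , tt) , λ {M} m →
  ⟦⟧-closed₁ B
    (λ Γ Δ D p → subst (λ N → Γ ++ N ⊩ D) (sym (++-assoc M _ Δ)) (⊩-\\L Γ Δ M p (reify A m)))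
    (reflect B)
reflect (B // A) = (ax , tt) , λ {M} m →
  ⟦⟧-closed₁ B (λ Γ Δ D p → ⊩-//L Γ Δ M p (reify A m)) (reflect B)
reflect (A · B) Γ Δ D f = ⊩-·L Γ Δ (f (reflect A) (reflect B))
-- The test `f` at `A` itself yields the premise of `↻L`.
reflect (A ↻) D f with f (reflect A)
... | d , d-cf = ↻L d , d-cf

data ⟦_⟧* {Pr : Set a} : List (Type Pr) → List (Type Pr) → Set a where
  []  : ⟦ [] ⟧* []
  _∷_ : ∀ {A Γ M N} → ⟦ A ⟧ M → ⟦ Γ ⟧* N → ⟦ A ∷ Γ ⟧* (M ++ N)

infixr 5 _∷_

⟦⟧*-refl : (Γ : List (Type Pr)) → ⟦ Γ ⟧* Γ
⟦⟧*-refl []      = []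
⟦⟧*-refl (A ∷ Γ) = reflect A ∷ ⟦⟧*-refl Γ

-- By `reify` each member of `⟦ A ⟧` derives `A`, and `[]` derives nothing. The right rules of the
-- divisions need this.
⟦⟧*-nonempty : ∀ (Π : List⁺ (Type Pr)) → ⟦ toList Π ⟧* L → L ≢ []
⟦⟧*-nonempty (A ∷ Γ) (_∷_ {M = []}    x _) _ with () ← reify A x
⟦⟧*-nonempty (A ∷ Γ) (_∷_ {M = _ ∷ _} x _) ()

⟦⟧*-++ : ∀ {Γ Δ : List (Type Pr)} → ⟦ Γ ⟧* M → ⟦ Δ ⟧* N → ⟦ Γ ++ Δ ⟧* (M ++ N)
⟦⟧*-++ []       ys = ys
⟦⟧*-++ {N = N} (_∷_ {M = K} {N = K′} x xs) ys =
  subst ⟦ _ ⟧* (sym (++-assoc K K′ N)) (x ∷ ⟦⟧*-++ xs ys)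

⟦⟧*-split : ∀ Γ {Δ : List (Type Pr)} → ⟦ Γ ++ Δ ⟧* L →
            ∃₂ λ M N → ⟦ Γ ⟧* M × ⟦ Δ ⟧* N × M ++ N ≡ L
⟦⟧*-split []      xs = [] , _ , [] , xs , refl
⟦⟧*-split (A ∷ Γ) (_∷_ {M = K} x xs) with ⟦⟧*-split Γ xs
... | M , N , ys , zs , refl = K ++ M , N , x ∷ ys , zs , ++-assoc K M N

⟦⟧*-++⁺ : ∀ {Γ} (Π : List⁺ (Type Pr)) →
          ⟦ Γ ⟧* M → ⟦ toList Π ⟧* N → ⟦ toList (Γ ++⁺ Π) ⟧* (M ++ N)
⟦⟧*-++⁺ {Γ = Γ} Π xs ys = subst (λ Δ → ⟦ Δ ⟧* _) (sym (toList-++⁺ Γ Π)) (⟦⟧*-++ xs ys)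

⟦⟧*-split⁺ : ∀ Γ (Π : List⁺ (Type Pr)) → ⟦ toList (Γ ++⁺ Π) ⟧* L →
             ∃₂ λ M N → ⟦ Γ ⟧* M × ⟦ toList Π ⟧* N × M ++ N ≡ L
⟦⟧*-split⁺ Γ Π xs = ⟦⟧*-split Γ (subst (λ Δ → ⟦ Δ ⟧* _) (toList-++⁺ Γ Π) xs)

-- Induction on the derivation, cuts included: as `L` is arbitrary, a cut just feeds the
-- interpretation of one premise to the other.
sound : ∀ {Π : List⁺ (Type Pr)} → Π ⊢ C → ⟦ toList Π ⟧* L → ⟦ C ⟧ L
sound {C = C} ax (_∷_ x []) = subst ⟦ C ⟧ (sym (++-identityʳ _)) x
sound {C = C} (\\L {Γ} {Δ} {Π} d e) xs with ⟦⟧*-split⁺ Γ _ xs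
... | K , _ , ks , ys , refl with ⟦⟧*-split (toList Π) ys
... | M , _ , ms , _∷_ {M = F} {N = N} f ns , refl =
  subst (λ L → ⟦ C ⟧ (K ++ L)) (++-assoc M F N)
    (sound d (⟦⟧*-++⁺ _ ks (proj₂ f (sound e ms) ∷ ns)))
sound (\\R {Π} {A} {B} d) xs =
  ⊩-\\R (⟦⟧*-nonempty Π xs) (reify B (sound d (reflect A ∷ xs))) ,
  λ m → sound d (m ∷ xs)
sound {C = C} (//L {Γ} {Δ} {Π} d e) xs with ⟦⟧*-split⁺ Γ _ xs
... | K , _ , ks , _∷_ {M = F} f ys , refl with ⟦⟧*-split (toList Π) ys
... | M , N , ms , ns , refl =
  subst (λ L → ⟦ C ⟧ (K ++ L)) (++-assoc F M N)
    (sound d (⟦⟧*-++⁺ _ ks (proj₂ f (sound e ms) ∷ ns)))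
sound (//R {Π} {A} {B} d) xs =
  ⊩-//R (⟦⟧*-nonempty Π xs) (reify B (applied (reflect A))) , applied
  where
  applied : ∀ {M} → ⟦ A ⟧ M → ⟦ B ⟧ (_ ++ M)
  applied {M} m = subst (λ N → ⟦ B ⟧ (_ ++ N)) (++-identityʳ M) (sound d (⟦⟧*-++ xs (m ∷ [])))
sound {C = C} (·L {Γ} {Δ} {A} {B} d) xs with ⟦⟧*-split⁺ Γ _ xs
... | K , _ , ks , _∷_ {N = N} p ns , refl =
  -- `p` only gives membership in the closure of the products; closedness of `⟦ C ⟧` reduces the
  -- goal to actual products `M ++ M′`.
  ⟦⟧-closed {X = λ L → ∃₂ λ M M′ → ⟦ A ⟧ M × ⟦ B ⟧ M′ × M ++ M′ ≡ L} C K N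
    (λ Γ′ Δ′ D f → p Γ′ Δ′ D λ m m′ → f (_ , _ , m , m′ , refl))
    λ { (M , M′ , m , m′ , refl) →
        subst (λ L → ⟦ C ⟧ (K ++ L)) (sym (++-assoc M M′ N))
          (sound d (⟦⟧*-++⁺ _ ks (m ∷ m′ ∷ ns))) }
sound (·R {Π} d e) xs with ⟦⟧*-split (toList Π) xs
... | _ , _ , ms , ns , refl = λ Γ Δ D f → f (sound d ms) (sound e ns)
sound (cut {Γ} {Δ} {Π} d e) xs with ⟦⟧*-split⁺ Γ _ xs
... | _ , _ , ks , ys , refl with ⟦⟧*-split (toList Π) ys
... | _ , _ , ms , ns , refl = sound e (⟦⟧*-++⁺ _ ks (sound d ms ∷ ns))
sound (↻R d) xs D f = f (sound d xs)
sound {C = C} (↻L d) (_∷_ x []) =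
  subst ⟦ C ⟧ (sym (++-identityʳ _)) λ D f →
    -- Through `d`, every `m` passes the test `f` at `D`, so `x` can be used at this same `D`.
    x D λ {M} m → sound d (subst ⟦ _ ⟧* (++-identityʳ M) (m ∷ [])) D f
sound (rotate {Π} {Ψ} d) xs D f with ⟦⟧*-split (toList Ψ) xs
... | N , M , ns , ms , refl = ⊩-↻ M N (sound d (⟦⟧*-++ ms ns) D f)

theorem1 : ∀ {a} {Pr : Set a} {Π : List⁺ (Type Pr)} {C : Type Pr} →
    Π ⊢ C → Σ[ d ∈ Π ⊢ C ] CutFree d
-- Normalisation by evaluation: the derivation is interpreted at its own antecedent and read back.
theorem1 {Π = Π} {C = C} d = reify C (sound d (⟦⟧*-refl (toList Π)))
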